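{- Let $P$ be an $N$-free poset with no infinite antichains. Then there exist a chain $C$ of $P$ and a partition of $P$ into antichains such that every part of the partition intersects $C$.
   Context: Posets are not necessarily finite. A chain is a totally ordered subset; an antichain is a set of pairwise incomparable elements. A $4$-tuple $(a,b,c,d)$ of distinct elements of a poset $P$ is an $N$ in $P$ if $a<b$, $c<b$, $c<d$, and these are the only strict comparabilities among $a,b,c,d$. $P$ is $N$-free if it does not contain an $N$. -}

module Defs where

open import Axiom.Extensionality.Propositional using (Extensionality)
open import Axiom.ExcludedMiddle using (ExcludedMiddle)
open import Data.Product using (∃; ∃-syntax; _×_)
open import Data.Sum using (_⊎_)
open import Function.Bundles using (_⇔_)
open import Level using (Level; Setω; suc; _⊔_)
open import Relation.Binary.Bundles using (Poset)
open import Relation.Binary.Definitions using (_Respects_)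
open import Relation.Nullary using (¬_)
open import Relation.Unary using (Pred; Satisfiable; _∈_; _≬_; _≐_)
import Data.List.Membership.Setoid as Membership
import Relation.Binary.Properties.Poset as PosetProperties

-- The ambient classical set theory, made explicit.  ExcludedMiddle decides
-- every type, not only propositions, so it also yields choice: from ¬ ¬ A
-- it produces an element of A.  Function extensionality makes such choices
-- independent of how a decidable subset (a Bool-valued function) is presented.
record Classical : Setω where
  field
    excludedMiddle : ∀ {ℓ} → ExcludedMiddle ℓ
    extensionality : ∀ {a b} → Extensionality a b

module _ {c ℓ₁ ℓ₂ : Level} (P : Poset c ℓ₁ ℓ₂) where
  open Poset P
  open PosetProperties P using (_<_)
  open Membership Eq.setoid using () renaming (_∈_ to _∈ₗ_)

  Incomparable : Carrier → Carrier → Set ℓ₂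
  Incomparable x y = ¬ (x ≤ y) × ¬ (y ≤ x)

  -- A subset is a predicate that respects the equality _≈_ of the poset.
  -- With excluded middle the universe level of the predicate is immaterial.
  SubsetPred : Set (suc (c ⊔ ℓ₁ ⊔ ℓ₂))
  SubsetPred = Pred Carrier (c ⊔ ℓ₁ ⊔ ℓ₂)

  record IsChain (C : SubsetPred) : Set (c ⊔ ℓ₁ ⊔ ℓ₂) where
    field
      respects : C Respects _≈_
      total    : ∀ {x y} → x ∈ C → y ∈ C → x ≤ y ⊎ y ≤ x

  record IsAntichain (A : SubsetPred) : Set (c ⊔ ℓ₁ ⊔ ℓ₂) where
    field
      respects     : A Respects _≈_
      incomparable : ∀ {x y} → x ∈ A → y ∈ A → ¬ (x ≈ y) → Incomparable x y

  Finite : SubsetPred → Set (c ⊔ ℓ₁ ⊔ ℓ₂)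
  Finite A = ∃[ xs ] (∀ x → x ∈ A ⇔ x ∈ₗ xs)

  Infinite : SubsetPred → Set (c ⊔ ℓ₁ ⊔ ℓ₂)
  Infinite A = ¬ Finite A

  NoInfiniteAntichain : Set (suc (c ⊔ ℓ₁ ⊔ ℓ₂))
  NoInfiniteAntichain = ¬ (∃[ A ] IsAntichain A × Infinite A)

  -- Each of the six pairs is either strictly comparable or incomparable, so
  -- the four elements are automatically distinct.
  record IsN (a b c d : Carrier) : Set (ℓ₁ ⊔ ℓ₂) where
    field
      a<b : a < b
      c<b : c < b
      c<d : c < d
      a∥c : Incomparable a c
      a∥d : Incomparable a d
      b∥d : Incomparable b d

  NFree : Set (c ⊔ ℓ₁ ⊔ ℓ₂)
  NFree = ∀ a b c d → ¬ IsN a b c d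

  -- The partition is the set of subsets { part i | i : Index }.  Indices may
  -- repeat a part, hence overlapping parts are required to be equal as subsets
  -- rather than to have equal indices.
  record AntichainPartition : Set (suc (c ⊔ ℓ₁ ⊔ ℓ₂)) where
    field
      Index     : Set (c ⊔ ℓ₁ ⊔ ℓ₂)
      part      : Index → SubsetPred
      antichain : ∀ i → IsAntichain (part i)
      nonempty  : ∀ i → Satisfiable (part i)
      covers    : ∀ x → ∃[ i ] x ∈ part i
      disjoint  : ∀ i j → part i ≬ part j → part i ≐ part j

{-# OPTIONS --safe #-}
module Submission where

open import Defs
open import Axiom.UniquenessOfIdentityProofs using (module Decidable⇒UIP)
open import Data.Bool.Base using (Bool; T)
open import Data.Bool.Properties using (T-≡; ⇔→≡)
open import Data.Empty using (⊥)
open import Data.Fin.Base using (toℕ)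
open import Data.Fin.Properties using (pigeonhole)
open import Data.List.Base using (length)
open import Data.List.Membership.Setoid.Properties using (index-injective)
open import Data.List.Relation.Unary.Any using (index)
open import Data.Nat.Base as ℕ using (ℕ; zero; suc; s≤s)
open import Data.Nat.Properties using (m≤n⇒m<n∨m≡n; n<1+n; <-cmp)
open import Data.Product using (Σ; ∃; ∃-syntax; _×_; _,_; proj₁; proj₂)
open import Data.Sum using (_⊎_; inj₁; inj₂; [_,_]′; map; swap)
open import Data.Unit using (⊤)
open import Function using (_∘_; id)
open import Function.Bundles using (mk⇔; _⇔_; Equivalence)
open import Induction.WellFounded using (Acc; acc; WellFounded)
open import Level using (Level; _⊔_; Lift; lift; lower)
open import Relation.Binary.Bundles using (Poset)
open import Relation.Binary.Core using (Rel)
open import Relation.Binary.Definitions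
  using (Reflexive; Symmetric; Transitive; tri<; tri≈; tri>)
open import Relation.Binary.PropositionalEquality
  using (_≡_; _≢_; refl; sym; trans; cong; subst)
open import Relation.Nullary using (¬_; Dec; yes; no; contradiction)
open import Relation.Nullary.Decidable using (⌊_⌋; toWitness; fromWitness; decidable-stable)
open import Relation.Unary using (Pred; _≬_)
import Relation.Binary.Properties.Poset as PosetProperties

-- The comparability graph of an N-free poset has no induced path P₄.  A retraction f
-- whose image is a clique and whose fibres are independent sets is what is needed.
-- Such retractions combine over joins, and over disjoint unions by injecting all
-- cliques into one of largest cardinality.  The vertex set is the join of its
-- components in the complement graph.  Each of these is a single vertex or
-- disconnected, since otherwise it contains an infinite independent set.  So one
-- passes to the components of these components, and so on.  This terminates: every
-- descent leaves behind a vertex nonadjacent to the component it enters, hence an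
-- infinite descent leaves behind an infinite independent set.

module _ (classical : Classical) where
  open Classical classical

  private variable
    a b d ℓ n r s : Level

  -- Choice from excluded middle.

  em : (A : Set a) → Dec A
  em A = excludedMiddle {P = A}

  stable : {A : Set a} → ¬ ¬ A → A
  stable {A = A} = decidable-stable (em A)

  ¬∀⇒∃¬ : {A : Set a} {D : Pred A d} {B : Pred A b} →
          ¬ (∀ x → D x → B x) → ∃[ x ] D x × ¬ B x
  ¬∀⇒∃¬ ¬all = stable λ none → ¬all λ x dx → stable λ ¬bx → none (x , dx , ¬bx)

  -- Deciding `∃ (R i)` rather than `D i` gives values that do not depend on proofs of `D i`; where
  -- there is no witness, `default` fills in.
  choice : {I : Set a} {A : Set b} {D : Pred I d} {R : I → Pred A r} →
           (I → A) → (∀ i → D i → ∃ (R i)) → ∃[ f ] ∀ i → D i → R i (f i)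
  choice {I = I} {A = A} {D = D} {R = R} default total =
    (λ i → pick i (em _)) , λ i → picked i (em _)
    where
    pick : ∀ i → Dec (∃ (R i)) → A
    pick i (yes (x , _)) = x
    pick i (no _)        = default i

    picked : ∀ i (q : Dec (∃ (R i))) → D i → R i (pick i q)
    picked i (yes (_ , rx)) _  = rx
    picked i (no none)      di = contradiction (total i di) none

  Bool-ext : {Y : Set a} {U V : Y → Bool} →
             (∀ y → T (U y) → T (V y)) → (∀ y → T (V y) → T (U y)) → U ≡ V
  Bool-ext to from = extensionality λ y → ⇔→≡ (mk⇔
    (Equivalence.to T-≡ ∘ to y ∘ Equivalence.from T-≡)
    (Equivalence.to T-≡ ∘ from y ∘ Equivalence.from T-≡))

  -- The representative of x is chosen from its class as a Bool-valued function;
  -- by extensionality this function is the same for all members of the class.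
  module Representative {X : Set a} (_∼_ : Rel X ℓ)
    (∼-sym : Symmetric _∼_) (∼-trans : Transitive _∼_) where

    private
      class : X → X → Bool
      class x y = ⌊ em (x ∼ y) ⌋

      class-cong : ∀ {x y} → x ∼ y → class x ≡ class y
      class-cong x∼y = Bool-ext
        (λ z → fromWitness ∘ ∼-trans (∼-sym x∼y) ∘ toWitness)
        (λ z → fromWitness ∘ ∼-trans x∼y ∘ toWitness)

      pick : (U : X → Bool) → X → Dec (∃ (T ∘ U)) → X
      pick U x (yes (y , _)) = y
      pick U x (no _)        = x

      picked : ∀ U x (q : Dec (∃ (T ∘ U))) → ∃ (T ∘ U) → T (U (pick U x q))
      picked U x (yes (_ , uy)) _ = uy
      picked U x (no none)      e = contradiction e none

      pick-irrelevant : ∀ U x y (q : Dec (∃ (T ∘ U))) → ∃ (T ∘ U) → pick U x q ≡ pick U y q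
      pick-irrelevant U x y (yes _)   _ = refl
      pick-irrelevant U x y (no none) e = contradiction e none

    rep : X → X
    rep x = pick (class x) x (em _)

    ∼-rep : ∀ {x} → x ∼ x → x ∼ rep x
    ∼-rep {x} x∼x = toWitness (picked (class x) x (em _) (x , fromWitness x∼x))

    rep-cong : ∀ {x y} → x ∼ y → rep x ≡ rep y
    rep-cong {x} {y} x∼y = trans
      (pick-irrelevant (class x) x y (em _) (y , fromWitness x∼y))
      (cong (λ U → pick U y (em _)) (class-cong x∼y))

  -- Zorn's lemma for cliques: the tower generated by adding one element at a
  -- time and by arbitrary unions is linearly ordered, hence its union is again
  -- a clique in the tower and cannot be enlarged.
  module MaximalClique {Y : Set a} (_≎_ : Rel Y ℓ)
    (≎-refl : Reflexive _≎_) (≎-sym : Symmetric _≎_) where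

    Clique : (Y → Bool) → Set (a ⊔ ℓ)
    Clique U = ∀ {x y} → T (U x) → T (U y) → x ≎ y

    private
      _⊑_ : Rel (Y → Bool) a
      U ⊑ V = ∀ y → T (U y) → T (V y)

      Addable : (Y → Bool) → Pred Y (a ⊔ ℓ)
      Addable U y = ¬ T (U y) × (∀ z → T (U z) → z ≎ y)

      extendWith : (U : Y → Bool) → Dec (∃ (Addable U)) → Y → Bool
      extendWith U (yes (y , _)) z = ⌊ em (T (U z) ⊎ z ≡ y) ⌋
      extendWith U (no _)          = U

      extend : (Y → Bool) → Y → Bool
      extend U = extendWith U (em _)

      union : ((Y → Bool) → Bool) → Y → Bool
      union F y = ⌊ em (∃[ U ] T (F U) × T (U y)) ⌋

      -- The empty family in `join` starts the tower. Families are Bool-valued, so the union of the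
      -- whole tower is again a member of it.
      data Tower : (Y → Bool) → Set a where
        grow : ∀ {U} → Tower U → Tower (extend U)
        join : ∀ F → (∀ U → T (F U) → Tower U) → Tower (union F)

      ⊑-extend : ∀ U → U ⊑ extend U
      ⊑-extend U = go (em _)
        where
        go : ∀ q → U ⊑ extendWith U q
        go (yes _) y uy = fromWitness (inj₁ uy)
        go (no _)  y uy = uy

      extend-clique : ∀ U → Clique U → Clique (extend U)
      extend-clique U cl = go (em _)
        where
        go : ∀ q → Clique (extendWith U q)
        go (no _) = cl
        go (yes (y , _ , comp)) {z} {w} tz tw
          with toWitness tz | toWitness tw
        ... | inj₁ uz   | inj₁ uw   = cl uz uw
        ... | inj₁ uz   | inj₂ refl = comp z uz
        ... | inj₂ refl | inj₁ uw   = ≎-sym (comp w uw)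
        ... | inj₂ refl | inj₂ refl = ≎-refl

      extend-maximal : ∀ U → extend U ⊑ U → ∀ y → (∀ z → T (U z) → z ≎ y) → T (U y)
      extend-maximal U = go (em _)
        where
        go : ∀ q → extendWith U q ⊑ U → ∀ y → (∀ z → T (U z) → z ≎ y) → T (U y)
        go (yes (y , ¬uy , _)) le _ _ = contradiction (le y (fromWitness (inj₂ refl))) ¬uy
        go (no none) _ y comp = stable λ ¬uy → none (y , ¬uy , comp)

      -- For a union, either one member contains `extend V` or all lie in `V`. For `extend U` with
      -- `U ⊑ V`, comparing `V` with `U` gives `extend U ⊑ V` or mutual inclusion, hence `U ≡ V` by
      -- extensionality.
      compare : ∀ {U V} → Tower U → Tower V → U ⊑ V ⊎ extend V ⊑ U
      compare {V = V} (join F ts) t with em (∃[ W ] T (F W) × extend V ⊑ W)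
      ... | yes (W , fW , le) = inj₂ λ y vy → fromWitness (W , fW , le y vy)
      ... | no none = inj₁ λ y uy → let W , fW , wy = toWitness uy in
        [ (λ le → le y wy) , (λ le → contradiction (W , fW , le) none) ]′ (compare (ts W fW) t)
      compare (grow {U} t′) t with compare t′ t
      ... | inj₂ le = inj₂ λ y vy → ⊑-extend U y (le y vy)
      ... | inj₁ U⊑V with compare t t′
      ...   | inj₂ le = inj₁ le
      ...   | inj₁ V⊑U with Bool-ext U⊑V V⊑U
      ...     | refl = inj₂ λ y uy → uy

      tower-clique : ∀ {U} → Tower U → Clique U
      tower-clique (grow {U} t) = extend-clique U (tower-clique t)
      tower-clique (join F ts) tx ty
        with toWitness tx | toWitness ty
      ... | U , fU , ux | V , fV , vy with compare (ts U fU) (ts V fV)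
      ...   | inj₁ le = tower-clique (ts V fV) (le _ ux) vy
      ...   | inj₂ le = tower-clique (ts U fU) ux (le _ (⊑-extend V _ vy))

      top : Y → Bool
      top = union (λ U → ⌊ em (Tower U) ⌋)

      top-tower : Tower top
      top-tower = join _ (λ U → toWitness)

    maximalClique : ∃[ M ] Clique M × (∀ y → (∀ z → T (M z) → z ≎ y) → T (M y))
    maximalClique = top , tower-clique top-tower ,
      extend-maximal top λ y ty → fromWitness (extend top , fromWitness (grow top-tower) , ty)

  -- Cardinalities of subsets, compared by injections.

  module _ {X : Set a} where

    infix 4 _≼_
    _≼_ : Pred X s → Pred X r → Set (a ⊔ s ⊔ r)
    A ≼ B = Σ (X → X) λ g → (∀ x → A x → B (g x)) × (∀ x y → A x → A y → g x ≡ g y → x ≡ y)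

    ≼-refl : (A : Pred X s) → A ≼ A
    ≼-refl A = id , (λ x ax → ax) , λ x y ax ay eq → eq

    ≼-trans : {A : Pred X s} {B : Pred X r} {C : Pred X ℓ} → A ≼ B → B ≼ C → A ≼ C
    ≼-trans (f , fA , f-inj) (g , gB , g-inj) =
      g ∘ f , (λ x → gB (f x) ∘ fA x) ,
      λ x y ax ay eq → f-inj x y ax ay (g-inj (f x) (f y) (fA x ax) (fA y ay) eq)

    -- A maximal partial injection between A and B exhausts A or B.
    ≼-total : (A : Pred X s) (B : Pred X r) → A ≼ B ⊎ B ≼ A
    ≼-total A B = go (em _)
      where
      -- The cliques of this relation are the partial injections.
      _≎_ : Rel (Σ (X × X) λ (x , y) → A x × B y) _
      ((x , y) , _) ≎ ((x′ , y′) , _) = x ≡ x′ ⇔ y ≡ y′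

      open MaximalClique _≎_ (mk⇔ (λ _ → refl) (λ _ → refl))
        (λ e → mk⇔ (sym ∘ Equivalence.to e ∘ sym) (sym ∘ Equivalence.from e ∘ sym))

      M-clique = proj₁ (proj₂ maximalClique)
      M-maximal = proj₂ (proj₂ maximalClique)

      Matched : Rel X _
      Matched x y = ∃[ ab ] T (proj₁ maximalClique ((x , y) , ab))

      go : Dec (∀ x → A x → ∃[ y ] Matched x y) → A ≼ B ⊎ B ≼ A
      go (yes left) =
        let g , matched = choice id left in
        inj₁ (g , (λ x ax → proj₂ (proj₁ (matched x ax))) , λ x y ax ay eq →
          Equivalence.from (M-clique (proj₂ (matched x ax)) (proj₂ (matched y ay))) eq)
      go (no ¬left) =
        -- Since `x₀` is unmatched, an unmatched `y` would let the pair of `x₀` and `y` enlarge the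
        -- maximal clique.
        let x₀ , ax₀ , unmatched = ¬∀⇒∃¬ ¬left
            g , matched = choice {R = λ y x → Matched x y} id λ y by → stable λ none → unmatched
              (y , (ax₀ , by) , M-maximal _ λ { ((x , y′) , ab) mz → mk⇔
                (λ { refl → contradiction (y′ , ab , mz) unmatched })
                (λ { refl → contradiction (x , ab , mz) none }) })
        in
        inj₂ (g , (λ y by → proj₁ (proj₁ (matched y by))) , λ x y bx by eq →
          Equivalence.to (M-clique (proj₂ (matched x bx)) (proj₂ (matched y by))) eq)

  -- Connected components.

  -- The composite of N with itself inside S reaches everything that longer
  -- N-paths in S reach, because every N-path of three steps has a shortcut.
  module TwoStep {X : Set a} (N : Rel X n) (N-refl : Reflexive N) (N-sym : Symmetric N)
    (shortcut : ∀ {x z w y} → N x z → N z w → N w y → N x w ⊎ N z y ⊎ N x y) where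

    infix 4 _≈[_]_
    _≈[_]_ : X → Pred X s → X → Set (a ⊔ n ⊔ s)
    x ≈[ S ] y = S x × S y × ∃[ z ] S z × N x z × N z y

    module _ {S : Pred X s} where

      ≈-refl : ∀ {x} → S x → x ≈[ S ] x
      ≈-refl sx = sx , sx , _ , sx , N-refl , N-refl

      N⇒≈ : ∀ {x y} → S x → S y → N x y → x ≈[ S ] y
      N⇒≈ sx sy xy = sx , sy , _ , sx , N-refl , xy

      ≈-sym : ∀ {x y} → x ≈[ S ] y → y ≈[ S ] x
      ≈-sym (sx , sy , z , sz , xz , zy) = sy , sx , z , sz , N-sym zy , N-sym xz

      ≈-step : ∀ {x y w} → x ≈[ S ] w → S y → N w y → x ≈[ S ] y
      ≈-step (sx , sw , z , sz , xz , zw) sy wy with shortcut xz zw wy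
      ... | inj₁ xw        = sx , sy , _ , sw , xw , wy
      ... | inj₂ (inj₁ zy) = sx , sy , z , sz , xz , zy
      ... | inj₂ (inj₂ xy) = N⇒≈ sx sy xy

      ≈-trans : ∀ {x y w} → x ≈[ S ] w → w ≈[ S ] y → x ≈[ S ] y
      ≈-trans xw (_ , sy , z , sz , wz , zy) = ≈-step (≈-step xw sz wz) sy zy

  -- Graphs without induced P₄ and without infinite independent sets.

  module Cograph {X : Set a} (_~_ : Rel X ℓ)
    (~-irrefl : ∀ {x} → ¬ x ~ x) (~-sym : Symmetric _~_)
    (P₄-free : ∀ {x y z w} → x ~ y → y ~ z → z ~ w → x ~ z ⊎ y ~ w ⊎ x ~ w)
    (no-infinite-independent : (y : ℕ → X) →
      (∀ {i j} → i ℕ.< j → y i ≢ y j × ¬ y i ~ y j) → ⊥) where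

    -- Past t contains the elements produced before reaching state t.
    no-independent-process : {S : Set s} (out : S → X) (Past : S → Pred X r) →
      (∀ {t x} → Past t x → x ≢ out t × ¬ x ~ out t) →
      (∀ t → ∃[ t′ ] Past t′ (out t) × (∀ {x} → Past t x → Past t′ x)) →
      ¬ S
    no-independent-process {S = S} out Past independent step start =
      no-infinite-independent (out ∘ state) (λ i<j → independent (past i<j))
      where
      state : ℕ → S
      state zero    = start
      state (suc i) = proj₁ (step (state i))

      past : ∀ {i j} → i ℕ.< j → Past (state j) (out (state i))
      past {i} {suc j} (s≤s i≤j) with m≤n⇒m<n∨m≡n i≤j
      ... | inj₁ i<j  = proj₂ (proj₂ (step (state j))) (past i<j)
      ... | inj₂ refl = proj₁ (proj₂ (step (state j)))

    _≃_ : Rel X _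
    x ≃ y = x ≡ y ⊎ x ~ y

    _≁_ : Rel X _
    x ≁ y = ¬ x ~ y

    ≃-sym : Symmetric _≃_
    ≃-sym (inj₁ refl) = inj₁ refl
    ≃-sym (inj₂ xy)   = inj₂ (~-sym xy)

    ≁-sym : Symmetric _≁_
    ≁-sym x≁y = x≁y ∘ ~-sym

    ≃-shortcut : ∀ {x z w y} → x ≃ z → z ≃ w → w ≃ y → x ≃ w ⊎ z ≃ y ⊎ x ≃ y
    ≃-shortcut (inj₁ refl) zw (inj₁ refl) = inj₁ zw
    ≃-shortcut (inj₁ refl) zw (inj₂ wy)   = inj₁ zw
    ≃-shortcut (inj₂ xz) (inj₁ refl) wy   = inj₁ (inj₂ xz)
    ≃-shortcut (inj₂ xz) (inj₂ zw) (inj₁ refl) = inj₂ (inj₁ (inj₂ zw))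
    ≃-shortcut (inj₂ xz) (inj₂ zw) (inj₂ wy) with P₄-free xz zw wy
    ... | inj₁ xw        = inj₁ (inj₂ xw)
    ... | inj₂ (inj₁ zy) = inj₂ (inj₁ (inj₂ zy))
    ... | inj₂ (inj₂ xy) = inj₂ (inj₂ (inj₂ xy))

    -- The complement of the path P₄ is again a P₄.
    ≁-shortcut : ∀ {x z w y} → x ≁ z → z ≁ w → w ≁ y → x ≁ w ⊎ z ≁ y ⊎ x ≁ y
    ≁-shortcut x≁z z≁w w≁y = stable λ none →
      -- Otherwise w, x, y, z is an induced path.
      [ w≁y , [ x≁z , z≁w ∘ ~-sym ]′ ]′ (P₄-free
        (~-sym (stable (none ∘ inj₁)))
        (stable (none ∘ inj₂ ∘ inj₂))
        (~-sym (stable (none ∘ inj₂ ∘ inj₁))))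

    -- The superscript c marks components of the graph, i those of its complement.
    open TwoStep _≃_ (inj₁ refl) ≃-sym ≃-shortcut using () renaming
      (_≈[_]_ to _≈ᶜ[_]_; ≈-refl to ≈ᶜ-refl; N⇒≈ to ≃⇒≈ᶜ; ≈-sym to ≈ᶜ-sym; ≈-trans to ≈ᶜ-trans)
    open TwoStep _≁_ ~-irrefl ≁-sym ≁-shortcut using () renaming
      (_≈[_]_ to _≈ⁱ[_]_; ≈-refl to ≈ⁱ-refl; N⇒≈ to ≁⇒≈ⁱ; ≈-sym to ≈ⁱ-sym; ≈-trans to ≈ⁱ-trans)

    -- Given v ~ x, connectedness of the complement yields w with v ≁ w ≁ x, and
    -- connectedness yields u with w ~ u ~ x.  As there is no induced P₄, passing
    -- from v to u keeps every earlier w adjacent to u and nonadjacent to the new one.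
    connected∧coconnected⇒singleton : {S : Pred X s} →
      (∀ {x y} → S x → S y → x ≈ᶜ[ S ] y) → (∀ {x y} → S x → S y → x ≈ⁱ[ S ] y) →
      ∀ {x y} → S x → S y → x ≡ y
    connected∧coconnected⇒singleton {S = S} connected coconnected {x} {y} sx sy =
      stable λ x≢y → no-independent-process out Past (λ {t} → independent {t}) step (start x≢y)
      where
      State = ∃[ v ] S v × v ~ x

      out : State → X
      out (v , sv , _) = proj₁ (proj₂ (proj₂ (coconnected sv sx)))

      Past : State → Pred X _
      Past (v , _) y = y ≁ x × y ~ v

      -- Otherwise x, v, y, w is an induced path.
      past-avoids-new : ∀ {v w y} → v ~ x → v ≁ w → w ≁ x → y ≁ x → y ~ v → y ≁ w
      past-avoids-new v~x v≁w w≁x y≁x y~v y~w =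
        [ y≁x ∘ ~-sym , [ v≁w , w≁x ∘ ~-sym ]′ ]′ (P₄-free (~-sym v~x) (~-sym y~v) y~w)

      independent : ∀ {t y} → Past t y → y ≢ out t × y ≁ out t
      independent {v , sv , v~x} (y≁x , y~v) with coconnected sv sx
      ... | _ , _ , w , _ , v≁w , w≁x =
        (λ { refl → v≁w (~-sym y~v) }) , past-avoids-new v~x v≁w w≁x y≁x y~v

      start : x ≢ y → State
      start x≢y with connected sx sy
      ... | _ , _ , z , sz , inj₂ x~z , _         = z , sz , ~-sym x~z
      ... | _ , _ , z , sz , inj₁ refl , inj₁ eq  = contradiction eq x≢y
      ... | _ , _ , z , sz , inj₁ refl , inj₂ x~y = y , sy , ~-sym x~y

      step : ∀ t → ∃[ t′ ] Past t′ (out t) × (∀ {y} → Past t y → Past t′ y)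
      step (v , sv , v~x) with coconnected sv sx
      ... | _ , _ , w , sw , v≁w , w≁x with connected sw sx
      ...   | _ , _ , u , su , inj₁ refl , inj₁ refl = contradiction v~x v≁w
      ...   | _ , _ , u , su , inj₁ refl , inj₂ w~x = contradiction w~x w≁x
      ...   | _ , _ , u , su , inj₂ w~u , inj₁ refl = contradiction w~u w≁x
      ...   | _ , _ , u , su , inj₂ w~u , inj₂ u~x =
        (u , su , u~x) , (w≁x , w~u) , λ (y≁x , y~v) → y≁x ,
          -- Otherwise y, v, u, w is an induced path.
          stable λ y≁u → [ y≁u , [ v≁w , past-avoids-new v~x v≁w w≁x y≁x y~v ]′ ]′
            (P₄-free y~v v~u (~-sym w~u))
        where
        -- Otherwise w, u, x, v is an induced path.
        v~u : v ~ u
        v~u = stable λ v≁u →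
          [ w≁x , [ v≁u ∘ ~-sym , v≁w ∘ ~-sym ]′ ]′ (P₄-free w~u u~x (~-sym v~x))

    -- Clique retractions, combined over components.

    -- The image of f is the clique and its fibres are the colour classes.
    record CliqueRetraction (S : Pred X s) (f : X → X) : Set (a ⊔ ℓ ⊔ s) where
      field
        closed     : ∀ {x} → S x → S (f x)
        idempotent : ∀ {x} → S x → f (f x) ≡ f x
        clique     : ∀ {x y} → S x → S y → f x ≢ f y → f x ~ f y
        proper     : ∀ {x y} → S x → S y → f x ≡ f y → x ≁ y

    open CliqueRetraction

    -- Distinct components of the complement are completely adjacent, so their cliques unite to a
    -- clique and colour classes stay within components. Using the retraction of the representative
    -- makes it the same throughout a component.
    retract-join : (S : Pred X s) →
      (∀ x → S x → ∃[ f ] CliqueRetraction (x ≈ⁱ[ S ]_) f) → ∃[ f ] CliqueRetraction S f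
    retract-join S pieces with choice (λ _ → id) pieces
    ... | F , F-retr = f , record
      { closed     = λ sx → proj₁ (proj₂ (f-part sx))
      ; idempotent = λ {x} sx → trans (cong (λ j → F j (f x)) (sym (rep-f sx)))
                                      (idempotent (retr sx) (part sx))
      ; clique     = f-clique
      ; proper     = f-proper
      }
      where
      open Representative (λ x y → x ≈ⁱ[ S ] y) ≈ⁱ-sym ≈ⁱ-trans

      f : X → X
      f x = F (rep x) x

      part : ∀ {x} → S x → rep x ≈ⁱ[ S ] x
      part sx = ≈ⁱ-sym (∼-rep (≈ⁱ-refl sx))

      retr : ∀ {x} → S x → CliqueRetraction (rep x ≈ⁱ[ S ]_) (F (rep x))
      retr sx = F-retr _ (proj₁ (part sx))

      f-part : ∀ {x} → S x → rep x ≈ⁱ[ S ] f x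
      f-part sx = closed (retr sx) (part sx)

      rep-f : ∀ {x} → S x → rep x ≡ rep (f x)
      rep-f sx = rep-cong (≈ⁱ-trans (≈ⁱ-sym (part sx)) (f-part sx))

      same-part : ∀ {x y} → S x → S y → f x ≡ f y → rep x ≡ rep y
      same-part sx sy eq = trans (rep-f sx) (trans (cong rep eq) (sym (rep-f sy)))

      f-clique : ∀ {x y} → S x → S y → f x ≢ f y → f x ~ f y
      f-clique {x} {y} sx sy fx≢fy = stable λ fx≁fy →
        -- Nonadjacent values lie in one component of the complement, so a single retraction governs
        -- both.
        let fx≈fy = ≁⇒≈ⁱ (proj₁ (proj₂ (f-part sx))) (proj₁ (proj₂ (f-part sy))) fx≁fy
            eq = trans (rep-f sx) (trans (rep-cong fx≈fy) (sym (rep-f sy)))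
            fy≡ = cong (λ j → F j y) eq
        in fx≁fy (subst (f x ~_) fy≡ (clique (retr sx) (part sx)
             (subst (_≈ⁱ[ S ] y) (sym eq) (part sy)) (λ e → fx≢fy (trans e fy≡))))

      f-proper : ∀ {x y} → S x → S y → f x ≡ f y → x ≁ y
      f-proper {x} {y} sx sy fx≡fy =
        let eq = same-part sx sy fx≡fy
        in proper (retr sx) (part sx) (subst (_≈ⁱ[ S ] y) (sym eq) (part sy))
             (trans fx≡fy (cong (λ j → F j y) (sym eq)))

    -- The clique of a component whose clique has maximal cardinality meets the
    -- colour classes of the other components after these are injected into it.
    retract-disjoint-union : (S : Pred X s) → ∃ S →
      (∀ x → S x → ∃[ f ] CliqueRetraction (x ≈ᶜ[ S ]_) f) → ∃[ f ] CliqueRetraction S f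
    retract-disjoint-union S inhabited pieces with choice (λ _ → id) pieces
    ... | F , F-retr = f , record
      { closed     = λ sx → proj₁ (proj₂ (proj₁ (f-image sx)))
      ; idempotent = λ sx → f-fix (f-image sx)
      ; clique     = f-clique
      ; proper     = f-proper
      }
      where
      open Representative (λ x y → x ≈ᶜ[ S ] y) ≈ᶜ-sym ≈ᶜ-trans

      part : ∀ {x} → S x → rep x ≈ᶜ[ S ] x
      part sx = ≈ᶜ-sym (∼-rep (≈ᶜ-refl sx))

      retr : ∀ {x} → S x → CliqueRetraction (rep x ≈ᶜ[ S ]_) (F (rep x))
      retr sx = F-retr _ (proj₁ (part sx))

      Image : X → Pred X _
      Image j y = j ≈ᶜ[ S ] y × F j y ≡ y

      Largest : Pred X _
      Largest k = ∀ x → S x → Image (rep x) ≼ Image (rep k)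

      -- Otherwise vertices could be chosen whose components have strictly growing cliques. These
      -- components are distinct, so the vertices form an infinite independent set.
      largest-exists : ∃[ k ] S k × Largest k
      largest-exists = stable λ none → no-independent-process {S = ∃ S} proj₁
        (λ (k , sk) x → S x × ¬ (Image (rep k) ≼ Image (rep x)))
        (λ {(k , sk)} {x} (sx , k⋠x) →
          (λ { refl → k⋠x (≼-refl (Image (rep k))) }) ,
          λ x~k → k⋠x (subst (λ j → Image (rep k) ≼ Image j)
            (sym (rep-cong (≃⇒≈ᶜ sx sk (inj₂ x~k)))) (≼-refl (Image (rep k)))))
        (λ (k , sk) →
          let k′ , sk′ , k′⋠k = ¬∀⇒∃¬ (λ largest → none (k , sk , largest))
          in (k′ , sk′) , (sk , k′⋠k) , λ {x} (sx , k⋠x) → sx , λ k′≼x →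
            [ (λ k≼k′ → k⋠x (≼-trans {C = Image (rep x)} k≼k′ k′≼x)) , k′⋠k ]′
              (≼-total (Image (rep k)) (Image (rep k′))))
        inhabited

      k : X
      k = rep (proj₁ largest-exists)

      rep-k : rep k ≡ k
      rep-k = sym (rep-cong (∼-rep (≈ᶜ-refl (proj₁ (proj₂ largest-exists)))))

      -- The last clause makes the combined map fix the largest clique pointwise, whence its
      -- idempotence.
      InjectsFixing : X → (X → X) → Set _
      InjectsFixing j g = (∀ y → Image j y → Image k (g y)) ×
        (∀ y z → Image j y → Image j z → g y ≡ g z → y ≡ z) ×
        (j ≡ k → ∀ y → g y ≡ y)

      injections : ∃[ G ] ∀ j → Image j ≼ Image k → InjectsFixing j (G j)
      injections = choice (λ _ → id) λ j → inject j (em (j ≡ k))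
        where
        inject : ∀ j → Dec (j ≡ k) → Image j ≼ Image k → ∃ (InjectsFixing j)
        inject j (yes refl) _ = id , (λ y im → im) , (λ y z _ _ eq → eq) , λ _ y → refl
        inject j (no j≢k) (g , g-maps , g-inj) =
          g , g-maps , g-inj , λ j≡k → contradiction j≡k j≢k

      G = proj₁ injections

      f : X → X
      f x = G (rep x) (F (rep x) x)

      F-image : ∀ {x} → S x → Image (rep x) (F (rep x) x)
      F-image sx = closed (retr sx) (part sx) , idempotent (retr sx) (part sx)

      G-injects : ∀ {x} → S x → InjectsFixing (rep x) (G (rep x))
      G-injects {x} sx = proj₂ injections (rep x) (proj₂ (proj₂ largest-exists) x sx)

      f-image : ∀ {x} → S x → Image k (f x)
      f-image sx = proj₁ (G-injects sx) _ (F-image sx)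

      f-fix : ∀ {y} → Image k y → f y ≡ y
      f-fix {y} (k≈y@(_ , sy , _) , Fy≡y) = trans (cong (λ j → G j (F j y)) rep-y)
        (trans (cong (G k) Fy≡y)
          (trans (cong (λ j → G j y) (sym rep-y)) (proj₂ (proj₂ (G-injects sy)) rep-y y)))
        where
        rep-y : rep y ≡ k
        rep-y = trans (sym (rep-cong k≈y)) rep-k

      f-clique : ∀ {x y} → S x → S y → f x ≢ f y → f x ~ f y
      f-clique {x} {y} sx sy fx≢fy =
        let k≈fx , Ffx = f-image sx
            k≈fy , Ffy = f-image sy
            F-clique = clique (F-retr k (proj₁ k≈fx)) k≈fx k≈fy
        in subst (_~ f y) Ffx (subst (F k (f x) ~_) Ffy
             (F-clique λ eq → fx≢fy (trans (sym Ffx) (trans eq Ffy))))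

      -- Adjacent vertices share a component, hence an injection; cancelling it leaves properness of
      -- the retraction of that component.
      f-proper : ∀ {x y} → S x → S y → f x ≡ f y → x ≁ y
      f-proper {x} {y} sx sy fx≡fy x~y =
        proper (retr sx) (part sx) y-part
          (proj₁ (proj₂ (G-injects sx)) _ _ (F-image sx)
            (closed (retr sx) y-part , idempotent (retr sx) y-part)
            (trans fx≡fy (cong (λ j → G j (F j y)) (sym eq))))
          x~y
        where
        eq : rep x ≡ rep y
        eq = rep-cong (≃⇒≈ᶜ sx sy (inj₂ x~y))

        y-part : rep x ≈ᶜ[ S ] y
        y-part = subst (_≈ᶜ[ S ] y) (sym eq) (part sy)

    -- Well-founded descent to components of components.

    private
      -- This level is closed under taking components, so the descent stays within one type.
      Subset = Pred X (a ⊔ ℓ)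

    _⊏_ : Rel Subset (a ⊔ ℓ)
    K ⊏ S = (∀ {x} → K x → S x) × ∃[ y ] S y × ∀ {x} → K x → ¬ (y ≃ x)

    -- An inaccessible subset has an inaccessible predecessor; the vertices left behind along such a
    -- descent form an infinite independent set.
    ⊏-wellFounded : WellFounded _⊏_
    ⊏-wellFounded S₀ = stable λ ¬acc₀ → no-independent-process
      {S = ∃[ S ] ¬ Acc _⊏_ S}
      (λ (S , ¬acc) → proj₁ (proj₂ (proj₁ (proj₂ (smaller S ¬acc)))))
      (λ (S , _) y → ∀ {x} → S x → ¬ (y ≃ x))
      (λ {(S , ¬acc)} past →
        let _ , (_ , _ , sy , _) , _ = smaller S ¬acc
        in past sy ∘ inj₁ , past sy ∘ inj₂)
      (λ (S , ¬acc) →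
        let K , (K⊆S , _ , _ , apart) , ¬accK = smaller S ¬acc
        in (K , ¬accK) , apart , λ past → past ∘ K⊆S)
      (S₀ , ¬acc₀)
      where
      smaller : ∀ S → ¬ Acc _⊏_ S → ∃[ K ] K ⊏ S × ¬ Acc _⊏_ K
      smaller S ¬acc = ¬∀⇒∃¬ λ all → ¬acc (acc λ {K} → all K)

    retract : (S : Subset) → ∃[ f ] CliqueRetraction S f
    retract S₀ = go S₀ (⊏-wellFounded S₀)
      where
      go : ∀ S → Acc _⊏_ S → ∃[ f ] CliqueRetraction S f
      go S (acc rs) = retract-join S retract-part
        where
        retract-part : ∀ a → S a → ∃[ f ] CliqueRetraction (a ≈ⁱ[ S ]_) f
        retract-part a sa with em (∀ {x y} → a ≈ⁱ[ S ] x → a ≈ⁱ[ S ] y → x ≈ᶜ[ a ≈ⁱ[ S ]_ ] y)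
        ... | yes connected = id , record
          { closed     = id
          ; idempotent = λ _ → refl
          ; clique     = λ qx qy x≢y → contradiction (singleton qx qy) x≢y
          ; proper     = λ { _ _ refl → ~-irrefl }
          }
          where
          coconnected : ∀ {x y} → a ≈ⁱ[ S ] x → a ≈ⁱ[ S ] y → x ≈ⁱ[ a ≈ⁱ[ S ]_ ] y
          coconnected qx qy =
            -- The intermediate vertex is itself in the component, so the connection takes place
            -- inside it.
            let sx , _ , z , sz , x≁z , z≁y = ≈ⁱ-trans (≈ⁱ-sym qx) qy
            in qx , qy , z , ≈ⁱ-trans qx (≁⇒≈ⁱ sx sz x≁z) , x≁z , z≁y

          singleton : ∀ {x y} → a ≈ⁱ[ S ] x → a ≈ⁱ[ S ] y → x ≡ y
          singleton = connected∧coconnected⇒singleton connected coconnected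
        ... | no disconnected = retract-disjoint-union (a ≈ⁱ[ S ]_) (a , ≈ⁱ-refl sa)
          λ x qx → go (x ≈ᶜ[ a ≈ⁱ[ S ]_ ]_) (rs (component⊏ qx))
          where
          component⊏ : ∀ {x} → a ≈ⁱ[ S ] x → (x ≈ᶜ[ a ≈ⁱ[ S ]_ ]_) ⊏ S
          component⊏ qx =
            -- If every vertex were connected to `x`, all would be connected to each other; so some
            -- `y` is left behind.
            let y , qy , x≉y = ¬∀⇒∃¬ λ all → disconnected λ {y} {z} qy qz →
                  ≈ᶜ-trans (≈ᶜ-sym (all y qy)) (all z qz)
            in (λ (_ , qz , _) → proj₁ (proj₂ qz)) , y , proj₁ (proj₂ qy) ,
               λ x≈z@(_ , qz , _) y≃z → x≉y (≈ᶜ-trans x≈z (≃⇒≈ᶜ qz qy (≃-sym y≃z)))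

-- The comparability graph of an N-free poset.

module ComparabilityGraph (classical : Classical) {c ℓ₁ ℓ₂} (P : Poset c ℓ₁ ℓ₂)
  (N-free : NFree P) (no-infinite-antichain : NoInfiniteAntichain P) where

  open Poset P using (Carrier; _≈_; _≤_; module Eq)
  open PosetProperties P using (_<_; <-trans; <-irrefl; <-respˡ-≈; <-respʳ-≈)
  open Representative classical _≈_ Eq.sym Eq.trans

  private
    stable′ : ∀ {a} {A : Set a} → ¬ ¬ A → A
    stable′ = stable classical

  infix 4 _~_
  _~_ : Rel Carrier (ℓ₁ ⊔ ℓ₂)
  x ~ y = x < y ⊎ y < x

  ~-irrefl : ∀ {x} → ¬ x ~ x
  ~-irrefl = [ <-irrefl Eq.refl , <-irrefl Eq.refl ]′

  ~-resp : ∀ {x y z} → x ≈ y → x ~ z → y ~ z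
  ~-resp x≈y (inj₁ x<z) = inj₁ (<-respˡ-≈ x≈y x<z)
  ~-resp x≈y (inj₂ z<x) = inj₂ (<-respʳ-≈ x≈y z<x)

  ≉∧≁⇒incomparable : ∀ {x y} → ¬ x ≈ y → ¬ x ~ y → Incomparable P x y
  ≉∧≁⇒incomparable x≉y x≁y =
    (λ x≤y → x≁y (inj₁ (x≤y , x≉y))) , λ y≤x → x≁y (inj₂ (y≤x , x≉y ∘ Eq.sym))

  ~⇒comparable : ∀ {x y} → x ~ y → x ≤ y ⊎ y ≤ x
  ~⇒comparable = map proj₁ proj₁

  -- Orientations alternate along an induced P₄, by transitivity, so it is an N.
  P₄-free : ∀ {x y z w} → x ~ y → y ~ z → z ~ w → x ~ z ⊎ y ~ w ⊎ x ~ w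
  P₄-free (inj₁ x<y) (inj₁ y<z) _ = inj₁ (inj₁ (<-trans x<y y<z))
  P₄-free (inj₂ y<x) (inj₂ z<y) _ = inj₁ (inj₂ (<-trans z<y y<x))
  P₄-free _ (inj₁ y<z) (inj₁ z<w) = inj₂ (inj₁ (inj₁ (<-trans y<z z<w)))
  P₄-free _ (inj₂ z<y) (inj₂ w<z) = inj₂ (inj₁ (inj₂ (<-trans w<z z<y)))
  P₄-free (inj₁ x<y) (inj₂ z<y) (inj₁ z<w) = stable′ λ none →
    N-free _ _ _ _ record
      { a<b = x<y ; c<b = z<y ; c<d = z<w
      ; a∥c = ≉∧≁⇒incomparable
          (λ x≈z → none (inj₂ (inj₂ (~-resp (Eq.sym x≈z) (inj₁ z<w))))) (none ∘ inj₁)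
      ; a∥d = ≉∧≁⇒incomparable
          (λ x≈w → none (inj₁ (~-resp (Eq.sym x≈w) (inj₂ z<w)))) (none ∘ inj₂ ∘ inj₂)
      ; b∥d = ≉∧≁⇒incomparable
          (λ y≈w → none (inj₂ (inj₂ (swap (~-resp y≈w (inj₂ x<y)))))) (none ∘ inj₂ ∘ inj₁)
      }
  P₄-free (inj₂ y<x) (inj₁ y<z) (inj₂ w<z) = stable′ λ none →
    N-free _ _ _ _ record
      { a<b = w<z ; c<b = y<z ; c<d = y<x
      ; a∥c = ≉∧≁⇒incomparable
          (λ w≈y → none (inj₂ (inj₂ (swap (~-resp (Eq.sym w≈y) (inj₁ y<x))))))
          (none ∘ inj₂ ∘ inj₁ ∘ swap)
      ; a∥d = ≉∧≁⇒incomparable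
          (λ w≈x → none (inj₁ (~-resp w≈x (inj₁ w<z)))) (none ∘ inj₂ ∘ inj₂ ∘ swap)
      ; b∥d = ≉∧≁⇒incomparable
          (λ z≈x → none (inj₂ (inj₂ (~-resp z≈x (inj₂ w<z))))) (none ∘ inj₁ ∘ swap)
      }

  -- The range of the sequence, closed under `≈`, is an antichain, so it remains to see that no list
  -- enumerates it.
  no-infinite-independent : (y : ℕ → Carrier) →
    ¬ (∀ {i j} → i ℕ.< j → ¬ y i ≈ y j × ¬ y i ~ y j)
  no-infinite-independent y independent = no-infinite-antichain
    ( (λ x → Lift (c ⊔ ℓ₁ ⊔ ℓ₂) (∃[ i ] x ≈ y i))
    , record
      { respects     = λ { x≈z (lift (i , x≈yi)) → lift (i , Eq.trans (Eq.sym x≈z) x≈yi) }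
      ; incomparable = λ { (lift (i , x≈yi)) (lift (j , z≈yj)) x≉z →
          ≉∧≁⇒incomparable x≉z (nonadjacent i j x≉z x≈yi z≈yj) }
      }
    , λ (xs , finite) →
      let member = λ i → Equivalence.to (finite (y i)) (lift (i , Eq.refl))
          -- One more term than the list has entries: two terms share a position, hence are equal.
          i , j , i<j , eq = pigeonhole (n<1+n (length xs)) (λ i → index (member (toℕ i)))
      in proj₁ (independent i<j) (index-injective Eq.setoid (member (toℕ i)) (member (toℕ j)) eq)
    )
    where
    nonadjacent : ∀ i j {x z} → ¬ x ≈ z → x ≈ y i → z ≈ y j → ¬ x ~ z
    nonadjacent i j x≉z x≈yi z≈yj x~z with <-cmp i j
    ... | tri< i<j _ _  = proj₂ (independent i<j) (swap (~-resp z≈yj (swap (~-resp x≈yi x~z))))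
    ... | tri≈ _ refl _ = x≉z (Eq.trans x≈yi (Eq.sym z≈yj))
    ... | tri> _ _ j<i  = proj₂ (independent j<i) (swap (~-resp x≈yi (swap (~-resp z≈yj (swap x~z)))))

  -- The graph lives on the normal forms of _≈_, where _≈_ and _≡_ agree.
  Normal : Set c
  Normal = ∃[ x ] rep x ≡ x

  normal : Carrier → Normal
  normal x = rep x , rep-cong (Eq.sym (∼-rep Eq.refl))

  ≈⇒≡ : {p q : Normal} → proj₁ p ≈ proj₁ q → p ≡ q
  ≈⇒≡ {x , rx≡x} {y , ry≡y} x≈y with trans (sym rx≡x) (trans (rep-cong x≈y) ry≡y)
  -- Excluded middle decides equality, so by Hedberg's theorem the two proofs of normality agree.
  ... | refl = cong (x ,_) (Decidable⇒UIP.≡-irrelevant (λ u v → em classical (u ≡ v)) rx≡x ry≡y)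

  open Cograph classical {X = Normal} (λ p q → proj₁ p ~ proj₁ q) ~-irrefl swap P₄-free
    (λ y independent → no-infinite-independent (proj₁ ∘ y) λ i<j →
      proj₁ (independent i<j) ∘ ≈⇒≡ , proj₂ (independent i<j))

  abstract
    everything : ∃[ g ] CliqueRetraction (λ _ → Lift (c ⊔ ℓ₁ ⊔ ℓ₂) ⊤) g
    everything = retract _

  private
    g = proj₁ everything

    module g = CliqueRetraction (proj₂ everything)

  f : Carrier → Carrier
  f x = proj₁ (g (normal x))

  f-cong : ∀ {x y} → x ≈ y → f x ≡ f y
  f-cong x≈y = cong (proj₁ ∘ g)
    (≈⇒≡ (Eq.trans (Eq.sym (∼-rep Eq.refl)) (Eq.trans x≈y (∼-rep Eq.refl))))

  f-idempotent : ∀ x → f (f x) ≡ f x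
  f-idempotent x = cong proj₁ (trans
    (cong g (≈⇒≡ (Eq.sym (∼-rep Eq.refl))))
    (g.idempotent {normal x} _))

  f-clique : ∀ {x y} → ¬ f x ≈ f y → f x ~ f y
  f-clique fx≉fy = g.clique _ _ (fx≉fy ∘ Eq.reflexive ∘ cong proj₁)

  f-proper : ∀ {x y} → f x ≡ f y → ¬ x ~ y
  f-proper {x} {y} fx≡fy x~y = g.proper _ _ (≈⇒≡ (Eq.reflexive fx≡fy))
    (swap (~-resp (∼-rep Eq.refl) (swap (~-resp (∼-rep Eq.refl) x~y))))

-- The chain and the partition, read off from the retraction.

theorem8 : Classical →
    ∀ {c ℓ₁ ℓ₂} (P : Poset c ℓ₁ ℓ₂) → NFree P → NoInfiniteAntichain P →
    ∃[ C ] IsChain P C × (∃[ 𝒜 ] (∀ i → AntichainPartition.part {P = P} 𝒜 i ≬ C))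
theorem8 classical {c} {ℓ₁} {ℓ₂} P N-free no-infinite-antichain =
  Chain ,
  record
    { respects = λ x≈y (lift x≈fx) → lift (Eq.trans (Eq.sym x≈y)
        (Eq.trans x≈fx (Eq.reflexive (f-cong x≈y))))
    ; total = chain-total
    } ,
  record
    { Index     = Lift (ℓ₁ ⊔ ℓ₂) Carrier
    ; part      = λ i → Part (lower i)
    ; antichain = λ i → record
      { respects     = λ x≈y (lift eq) → lift (trans (sym (f-cong x≈y)) eq)
      ; incomparable = λ (lift ex) (lift ey) x≉y →
          ≉∧≁⇒incomparable x≉y (f-proper (trans ex (sym ey)))
      }
    ; nonempty  = λ i → lower i , lift refl
    ; covers    = λ x → lift x , lift refl
    ; disjoint  = λ { i j (x , lift ei , lift ej) →
        (λ (lift e) → lift (trans e (trans (sym ei) ej))) ,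
        (λ (lift e) → lift (trans e (trans (sym ej) ei))) }
    } ,
  -- By idempotence, the value of `f` at the index lies both in its fibre and in the chain.
  λ i → f (lower i) , lift (f-idempotent (lower i)) ,
        lift (Eq.reflexive (sym (f-idempotent (lower i))))
  where
  open Poset P using (Carrier; _≈_; _≤_; module Eq; reflexive)
  open ComparabilityGraph classical P N-free no-infinite-antichain

  -- By idempotence this is the image of `f`, closed under `≈`.
  Chain : SubsetPred P
  Chain x = Lift (c ⊔ ℓ₁ ⊔ ℓ₂) (x ≈ f x)

  Part : Carrier → SubsetPred P
  Part i x = Lift (c ⊔ ℓ₁ ⊔ ℓ₂) (f x ≡ f i)

  chain-total : ∀ {x y} → Chain x → Chain y → x ≤ y ⊎ y ≤ x
  chain-total {x} {y} (lift x≈fx) (lift y≈fy) with em classical (x ≈ y)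
  ... | yes x≈y = inj₁ (reflexive x≈y)
  ... | no x≉y  = ~⇒comparable (swap (~-resp (Eq.sym y≈fy) (swap (~-resp (Eq.sym x≈fx)
    (f-clique λ fx≈fy → x≉y (Eq.trans x≈fx (Eq.trans fx≈fy (Eq.sym y≈fy))))))))
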